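{- The class of $(2P_2,\overline{P_5},\overline{3P_2})$-free atoms has unbounded clique-width.
   Context: Graphs are finite, simple and undirected. A graph $G$ is $(H_1,\dots,H_p)$-free if it contains none of $H_1,\dots,H_p$ as an induced subgraph. A clique $K\subseteq V(G)$ (possibly empty) is a clique cut-set of $G$ if $G\setminus K$ is disconnected; an atom is a graph with no clique cut-set (so atoms are connected). $P_t$ is the path on $t$ vertices, $rG$ is the disjoint union of $r$ copies of $G$, and $\overline{G}$ is the complement of $G$. The clique-width $\mathrm{cw}(G)$ is the minimum number of labels needed to construct $G$ using four operations: create a new graph consisting of a single vertex with label $i$; take the disjoint union of two labelled graphs; add an edge between every vertex with label $i$ and every vertex with label $j$ ($i\ne j$); relabel every vertex with label $i$ to have label $j$. A class of graphs has bounded clique-width if there is a constant $c$ with $\mathrm{cw}(G)\le c$ for every $G$ in the class; otherwise its clique-width is unbounded. -}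

module Defs where

open import Data.Bool.Base using (if_then_else_)
open import Data.Empty using (⊥)
open import Data.Fin.Base using (Fin; toℕ)
import Data.Fin.Properties as Fin
open import Data.Fin.Subset using (Subset; _∈_; _∉_)
open import Data.Nat.Base using (ℕ; suc; _≤_; NonZero)
import Data.Nat.Properties as ℕ
open import Data.Product.Base using (_×_; _,_; ∃-syntax)
open import Data.Product.Properties using (≡-dec)
open import Data.Sum.Base as Sum using (_⊎_; inj₁; inj₂; [_,_]′)
open import Data.Unit.Base using (⊤)
open import Function.Base using (_∘_)
open import Function.Bundles using (_↔_; _⇔_; Inverse)
open import Function.Definitions using (Injective)
open import Level using (0ℓ)
open import Relation.Binary.Construct.Closure.ReflexiveTransitive using (Star)
open import Relation.Binary.Core using (Rel)
open import Relation.Binary.Definitions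
  using (Decidable; DecidableEquality; Irreflexive; Symmetric)
open import Relation.Binary.PropositionalEquality using (_≡_; _≢_; refl; sym; trans)
open import Relation.Nullary.Decidable using (does; no; _×-dec_; _⊎-dec_; ¬?)
open import Relation.Nullary.Negation using (¬_)

private
  variable
    V W : Set
    n k : ℕ

record Graph (V : Set) : Set₁ where
  field
    Adj        : Rel V 0ℓ
    adj?       : Decidable Adj
    adj-sym    : Symmetric Adj
    adj-irrefl : Irreflexive _≡_ Adj

open Graph public

record _≅_ (G : Graph V) (H : Graph W) : Set where
  field
    bijection : V ↔ W
    adj-⇔     : ∀ x y → Adj G x y ⇔ Adj H (Inverse.to bijection x) (Inverse.to bijection y)

record InducedSubgraph (H : Graph W) (G : Graph V) : Set where
  field
    embed     : W → V
    injective : Injective _≡_ _≡_ embed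
    adj-⇔     : ∀ x y → Adj H x y ⇔ Adj G (embed x) (embed y)

_-Free_ : Graph W → Graph V → Set
H -Free G = ¬ InducedSubgraph H G

P : (t : ℕ) → Graph (Fin t)
P t .Adj i j = suc (toℕ i) ≡ toℕ j ⊎ suc (toℕ j) ≡ toℕ i
P t .adj? i j = (suc (toℕ i) ℕ.≟ toℕ j) ⊎-dec (suc (toℕ j) ℕ.≟ toℕ i)
P t .adj-sym = Sum.swap
P t .adj-irrefl refl = [ ℕ.1+n≢n , ℕ.1+n≢n ]′

infixr 7 _·_

_·_ : (r : ℕ) → Graph V → Graph (Fin r × V)
(r · G) .Adj (a , x) (b , y) = a ≡ b × Adj G x y
(r · G) .adj? (a , x) (b , y) = (a Fin.≟ b) ×-dec adj? G x y
(r · G) .adj-sym (a≡b , xy) = sym a≡b , adj-sym G xy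
(r · G) .adj-irrefl refl (_ , xx) = adj-irrefl G refl xx

complement : DecidableEquality V → Graph V → Graph V
complement _≟_ G .Adj x y = x ≢ y × ¬ Adj G x y
complement _≟_ G .adj? x y = ¬? (x ≟ y) ×-dec ¬? (adj? G x y)
complement _≟_ G .adj-sym (x≢y , ¬xy) = x≢y ∘ sym , ¬xy ∘ adj-sym G
complement _≟_ G .adj-irrefl x≡y (x≢y , _) = x≢y x≡y

2P₂ : Graph (Fin 2 × Fin 2)
2P₂ = 2 · P 2

co-P₅ : Graph (Fin 5)
co-P₅ = complement Fin._≟_ (P 5)

co-3P₂ : Graph (Fin 3 × Fin 2)
co-3P₂ = complement (≡-dec Fin._≟_ Fin._≟_) (3 · P 2)

IsClique : Graph (Fin n) → Subset n → Set
IsClique G K = ∀ {u v} → u ∈ K → v ∈ K → u ≢ v → Adj G u v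

-- Adjacency in G ∖ K.  The vertices of K are kept in the carrier, as isolated
-- points; ConnectedAfterDeleting never looks at them.
_∖_ : Graph (Fin n) → Subset n → Rel (Fin n) 0ℓ
(G ∖ K) u v = u ∉ K × v ∉ K × Adj G u v

ConnectedAfterDeleting : Graph (Fin n) → Subset n → Set
ConnectedAfterDeleting G K = ∀ {u v} → u ∉ K → v ∉ K → Star (G ∖ K) u v

IsCliqueCutset : Graph (Fin n) → Subset n → Set
IsCliqueCutset G K = IsClique G K × ¬ ConnectedAfterDeleting G K

IsAtom : Graph (Fin n) → Set
IsAtom G = ∀ K → ¬ IsCliqueCutset G K

data Expr (k : ℕ) : Set where
  single  : (i : Fin k) → Expr k
  _⊕_     : Expr k → Expr k → Expr k
  join    : (i j : Fin k) → i ≢ j → Expr k → Expr k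
  relabel : (i j : Fin k) → Expr k → Expr k

Vertex : Expr k → Set
Vertex (single _)      = ⊤
Vertex (e ⊕ f)         = Vertex e ⊎ Vertex f
Vertex (join _ _ _ e)  = Vertex e
Vertex (relabel _ _ e) = Vertex e

label : (e : Expr k) → Vertex e → Fin k
label (single i)      _ = i
label (e ⊕ f)           = [ label e , label f ]′
label (join _ _ _ e)    = label e
label (relabel i j e) x = if does (label e x Fin.≟ i) then j else label e x

empty : Graph V
empty .Adj _ _ = ⊥
empty .adj? _ _ = no λ ()
empty .adj-sym ()
empty .adj-irrefl _ ()

_⊎ᵍ_ : Graph V → Graph W → Graph (V ⊎ W)
(G ⊎ᵍ H) .Adj (inj₁ x) (inj₁ y) = Adj G x y
(G ⊎ᵍ H) .Adj (inj₂ x) (inj₂ y) = Adj H x y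
(G ⊎ᵍ H) .Adj (inj₁ _) (inj₂ _) = ⊥
(G ⊎ᵍ H) .Adj (inj₂ _) (inj₁ _) = ⊥
(G ⊎ᵍ H) .adj? (inj₁ x) (inj₁ y) = adj? G x y
(G ⊎ᵍ H) .adj? (inj₂ x) (inj₂ y) = adj? H x y
(G ⊎ᵍ H) .adj? (inj₁ _) (inj₂ _) = no λ ()
(G ⊎ᵍ H) .adj? (inj₂ _) (inj₁ _) = no λ ()
(G ⊎ᵍ H) .adj-sym {inj₁ _} {inj₁ _} = adj-sym G
(G ⊎ᵍ H) .adj-sym {inj₂ _} {inj₂ _} = adj-sym H
(G ⊎ᵍ H) .adj-irrefl {inj₁ _} refl = adj-irrefl G refl
(G ⊎ᵍ H) .adj-irrefl {inj₂ _} refl = adj-irrefl H refl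

addEdges : (lab : V → Fin k) (i j : Fin k) → i ≢ j → Graph V → Graph V
addEdges lab i j i≢j G .Adj x y =
  Adj G x y ⊎ (lab x ≡ i × lab y ≡ j) ⊎ (lab x ≡ j × lab y ≡ i)
addEdges lab i j i≢j G .adj? x y =
  adj? G x y ⊎-dec
  ((lab x Fin.≟ i) ×-dec (lab y Fin.≟ j)) ⊎-dec
  ((lab x Fin.≟ j) ×-dec (lab y Fin.≟ i))
addEdges lab i j i≢j G .adj-sym (inj₁ xy) = inj₁ (adj-sym G xy)
addEdges lab i j i≢j G .adj-sym (inj₂ (inj₁ (p , q))) = inj₂ (inj₂ (q , p))
addEdges lab i j i≢j G .adj-sym (inj₂ (inj₂ (p , q))) = inj₂ (inj₁ (q , p))
addEdges lab i j i≢j G .adj-irrefl refl (inj₁ xx) = adj-irrefl G refl xx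
addEdges lab i j i≢j G .adj-irrefl refl (inj₂ (inj₁ (p , q))) = i≢j (trans (sym p) q)
addEdges lab i j i≢j G .adj-irrefl refl (inj₂ (inj₂ (p , q))) = i≢j (trans (sym q) p)

⟦_⟧ : (e : Expr k) → Graph (Vertex e)
⟦ single _ ⟧       = empty
⟦ e ⊕ f ⟧          = ⟦ e ⟧ ⊎ᵍ ⟦ f ⟧
⟦ join i j i≢j e ⟧ = addEdges (label e) i j i≢j ⟦ e ⟧
⟦ relabel _ _ e ⟧  = ⟦ e ⟧

Constructible : ℕ → Graph V → Set
Constructible k G = ∃[ e ] ⟦_⟧ {k} e ≅ G

CliqueWidth : Graph V → ℕ → Set
CliqueWidth G k = Constructible k G × (∀ j → Constructible j G → k ≤ j)

GraphClass : Set₁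
GraphClass = ∀ {n} → Graph (Fin n) → Set

-- No expression denotes the graph without vertices, so it has no clique-width;
-- it is excluded, as otherwise it alone would make a class unbounded.
BoundedCliqueWidth : GraphClass → Set₁
BoundedCliqueWidth C =
  ∃[ c ] (∀ {n} .{{_ : NonZero n}} (G : Graph (Fin n)) → C G →
          ∃[ k ] CliqueWidth G k × k ≤ c)

UnboundedCliqueWidth : GraphClass → Set₁
UnboundedCliqueWidth C = ¬ BoundedCliqueWidth C

{-# OPTIONS --safe #-}

-- Take a clique C on Fin N and, for all s and t in C, a "leaf" (s , t) whose
-- only neighbours are s and t; join this split graph with two non-adjacent
-- apices.  Any two non-adjacent vertices are the two apices or include a leaf,
-- and leaves are pairwise non-adjacent; this excludes the three induced
-- subgraphs.  No clique contains both apices or the whole split graph, so every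
-- vertex outside a clique K stays connected to an apex outside K.
--
-- A k-expression with more than 3k vertices in C has a subexpression containing
-- more than k and at most 2k of them, hence with sets S of those inside and T of
-- those outside of size > k.  If every t in T has an inside leaf (s , t), then
-- these leaves have pairwise different neighbourhoods outside; otherwise some t
-- has all its leaves (s , t) outside, and they distinguish the elements of S.
-- Either way the subexpression needs more than k labels.
module Submission where

open import Defs
open import Data.Empty using (⊥)
open import Data.Fin.Base using (Fin; zero; suc)
import Data.Fin.Base as Fin
open import Data.Fin using (#_)
import Data.Fin.Properties as Fin
open import Data.Fin.Subset using (Subset; _∉_)
open import Data.Fin.Subset.Properties using (_∈?_)
open import Data.List.Base
  using (List; []; _∷_; map; length; filter; lookup; mapMaybe; allFin)
open import Data.List.Membership.Propositional using (_∈_; find; lose)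
open import Data.List.Membership.Propositional.Properties using (∈-lookup; ∈-filter⁻)
open import Data.List.Properties using (filter-all; length-map; length-tabulate)
open import Data.List.Relation.Unary.All as All using (All; []; _∷_)
import Data.List.Relation.Unary.All.Properties as All
open import Data.List.Relation.Unary.AllPairs using (AllPairs; []; _∷_)
import Data.List.Relation.Unary.Any as Any
open import Data.List.Relation.Unary.Unique.Propositional using (Unique)
import Data.List.Relation.Unary.Unique.Propositional.Properties as Unique
open import Data.Maybe.Relation.Unary.All using (just; nothing)
open import Data.Nat.Base using (ℕ; suc; _+_; _*_; _≤_; _<_; s≤s; s<s)
import Data.Nat.Properties as ℕ
open import Data.Product.Base as Product using (_×_; _,_; ∃-syntax; proj₁; proj₂)
open import Data.Product.Properties using (≡-dec)
open import Data.Sum using (isInj₁; isInj₂)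
open import Data.Sum.Base as Sum using (_⊎_; inj₁; inj₂; [_,_]; [_,_]′)
open import Data.Sum.Function.Propositional using (_⊎-↔_)
open import Data.Sum.Properties using (inj₁-injective; inj₂-injective)
open import Data.Unit.Base using (⊤; tt)
open import Function.Base using (_∘_; const; id)
open import Function.Bundles using (_↔_; _⇔_; Inverse; Equivalence; Injection)
open import Function.Construct.Composition using (_↔-∘_; _⇔-∘_)
open import Function.Construct.Identity using (⇔-id)
open import Function.Construct.Symmetry using (⇔-sym)
open import Function.Properties.Inverse using (↔-sym; ↔-refl; Inverse⇒Injection)
open import Level using (0ℓ)
open import Relation.Binary.Construct.Closure.ReflexiveTransitive
  using (Star; ε; _◅_; _◅◅_; reverse)
open import Relation.Binary.Core using (Rel)
open import Relation.Binary.Definitions using (DecidableEquality)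
open import Relation.Binary.PropositionalEquality
  using (_≡_; _≢_; refl; sym; trans; cong; subst; subst₂)
open import Relation.Nullary.Decidable using (yes; no; ¬?; _⊎-dec_; True; toWitness)
open import Relation.Nullary.Negation using (¬_; contradiction)
open import Relation.Unary using (Pred; Decidable)

private
  variable
    A B V W : Set
    n k N : ℕ

-- Lists: sums, counting and the pigeonhole principle

lefts : List (A ⊎ B) → List A
lefts = mapMaybe isInj₁

rights : List (A ⊎ B) → List B
rights = mapMaybe isInj₂

length-lefts-rights : (xs : List (A ⊎ B)) →
                      length xs ≡ length (lefts xs) + length (rights xs)
length-lefts-rights []            = refl
length-lefts-rights (inj₁ _ ∷ xs) = cong suc (length-lefts-rights xs)
length-lefts-rights (inj₂ _ ∷ xs) =
  trans (cong suc (length-lefts-rights xs)) (sym (ℕ.+-suc _ _))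

unique-lefts : {xs : List (A ⊎ B)} → Unique xs → Unique (lefts xs)
unique-lefts {xs = []} [] = []
unique-lefts {xs = inj₁ x ∷ xs} (x∉xs ∷ u) =
  All.mapMaybe⁺ (All.map⁺ (All.map lemma x∉xs)) ∷ unique-lefts u
  where
  lemma : ∀ {y} → inj₁ x ≢ y → _
  lemma {inj₁ y} x≢y = just (x≢y ∘ cong inj₁)
  lemma {inj₂ y} _   = nothing
unique-lefts {xs = inj₂ _ ∷ xs} (_ ∷ u) = unique-lefts u

unique-rights : {xs : List (A ⊎ B)} → Unique xs → Unique (rights xs)
unique-rights {xs = []} [] = []
unique-rights {xs = inj₂ x ∷ xs} (x∉xs ∷ u) =
  All.mapMaybe⁺ (All.map⁺ (All.map lemma x∉xs)) ∷ unique-rights u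
  where
  lemma : ∀ {y} → inj₂ x ≢ y → _
  lemma {inj₂ y} x≢y = just (x≢y ∘ cong inj₂)
  lemma {inj₁ y} _   = nothing
unique-rights {xs = inj₁ _ ∷ xs} (_ ∷ u) = unique-rights u

length-filter-map : {P : Pred B 0ℓ} (P? : Decidable P) (f : A → B) (xs : List A) →
                    length (filter P? (map f xs)) ≡ length (filter (P? ∘ f) xs)
length-filter-map P? f [] = refl
length-filter-map P? f (x ∷ xs) with P? (f x)
... | yes _ = cong suc (length-filter-map P? f xs)
... | no  _ = length-filter-map P? f xs

length-filter-¬ : {P : Pred A 0ℓ} (P? : Decidable P) (xs : List A) →
                  length xs ≡ length (filter P? xs) + length (filter (¬? ∘ P?) xs)
length-filter-¬ P? [] = refl
length-filter-¬ P? (x ∷ xs) with P? x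
... | yes _ = cong suc (length-filter-¬ P? xs)
... | no  _ = trans (cong suc (length-filter-¬ P? xs)) (sym (ℕ.+-suc _ _))

lookup-AllPairs : {R : Rel A 0ℓ} {xs : List A} → AllPairs R xs →
                  ∀ {i j} → i Fin.< j → R (lookup xs i) (lookup xs j)
lookup-AllPairs (r ∷ _)  {zero}  {suc j} _         = All.lookup r (∈-lookup j)
lookup-AllPairs (_ ∷ rs) {suc i} {suc j} (s<s i<j) = lookup-AllPairs rs i<j

-- The colour `f` may depend on the membership proof, because the lower bound colours an element
-- through a witness extracted from its membership.
pigeonhole-∈ : {xs : List A} → Unique xs → k < length xs →
               (f : ∀ {x} → x ∈ xs → Fin k) →
               ∃[ x ] ∃[ y ] ∃[ p ] ∃[ q ] x ≢ y × f {x} p ≡ f {y} q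
pigeonhole-∈ {xs = xs} u k<n f =
  let i , j , i<j , eq = Fin.pigeonhole k<n (f ∘ ∈-lookup {xs = xs})
  in _ , _ , ∈-lookup i , ∈-lookup j , lookup-AllPairs u i<j , eq

-- Balanced cuts of expressions

-- The values of class outside Inside are junk.
record Cut (e : Expr k) : Set₁ where
  field
    Inside      : Pred (Vertex e) 0ℓ
    inside?     : Decidable Inside
    class       : Vertex e → Fin k
    class-label : ∀ {x y} → Inside x → Inside y → class x ≡ class y →
                  label e x ≡ label e y
    twins       : ∀ {x y z} → Inside x → Inside y → ¬ Inside z → class x ≡ class y →
                  Adj ⟦ e ⟧ x z → Adj ⟦ e ⟧ y z

open Cut

-- The starting point of every cut: `e` is the chosen subexpression, and the constructors below
-- carry the cut outwards. On inside vertices `class` thus stays the label held in that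
-- subexpression, while `label` keeps changing.
whole : (e : Expr k) → Cut e
whole e .Inside _          = ⊤
whole e .inside? _         = yes tt
whole e .class             = label e
whole e .class-label _ _   = id
whole e .twins _ _ outside = contradiction tt outside

-- The new outside vertices lie in `f` and have no neighbour in `e`, so `twins` holds vacuously for
-- them.
cut-⊕ˡ : {e : Expr k} (f : Expr k) → Cut e → Cut (e ⊕ f)
cut-⊕ˡ f c .Inside                                      = [ Inside c , const ⊥ ]′
cut-⊕ˡ f c .inside?                                     = [ inside? c , (λ _ → no λ ()) ]
cut-⊕ˡ f c .class                                       = [ class c , label f ]′
cut-⊕ˡ f c .class-label {inj₁ _} {inj₁ _}               = class-label c
cut-⊕ˡ f c .twins       {inj₁ _} {inj₁ _} {inj₁ _}      = twins c
cut-⊕ˡ f c .twins       {inj₁ _} {inj₁ _} {inj₂ _} _ _ _ _ ()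

cut-⊕ʳ : (e : Expr k) {f : Expr k} → Cut f → Cut (e ⊕ f)
cut-⊕ʳ e c .Inside                                      = [ const ⊥ , Inside c ]′
cut-⊕ʳ e c .inside?                                     = [ (λ _ → no λ ()) , inside? c ]
cut-⊕ʳ e c .class                                       = [ label e , class c ]′
cut-⊕ʳ e c .class-label {inj₂ _} {inj₂ _}               = class-label c
cut-⊕ʳ e c .twins       {inj₂ _} {inj₂ _} {inj₂ _}      = twins c
cut-⊕ʳ e c .twins       {inj₂ _} {inj₂ _} {inj₁ _} _ _ _ _ ()

-- This is where the invariant `class-label` is needed: the new edges depend on labels only, and
-- inside vertices of one class still share their label, so they gain the same outside neighbours.
cut-join : ∀ {e : Expr k} {i j} (i≢j : i ≢ j) → Cut e → Cut (join i j i≢j e)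
cut-join i≢j c .Inside      = Inside c
cut-join i≢j c .inside?     = inside? c
cut-join i≢j c .class       = class c
cut-join i≢j c .class-label = class-label c
cut-join i≢j c .twins x∈ y∈ z∉ eq =
  Sum.map (twins c x∈ y∈ z∉ eq) (Sum.map (Product.map₁ (trans same)) (Product.map₁ (trans same)))
  where same = sym (class-label c x∈ y∈ eq)

cut-relabel : ∀ {e : Expr k} i j → Cut e → Cut (relabel i j e)
cut-relabel i j c .Inside  = Inside c
cut-relabel i j c .inside? = inside? c
cut-relabel i j c .class   = class c
cut-relabel i j c .class-label x∈ y∈ eq
  rewrite class-label c x∈ y∈ eq = refl
cut-relabel i j c .twins   = twins c

inside-count : {e : Expr k} → Cut e → List (Vertex e) → ℕ
inside-count c xs = length (filter (inside? c) xs)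

inside-count-⊕ˡ : {e : Expr k} (f : Expr k) (c : Cut e) (xs : List (Vertex (e ⊕ f))) →
                  inside-count (cut-⊕ˡ f c) xs ≡ inside-count c (lefts xs)
inside-count-⊕ˡ f c [] = refl
inside-count-⊕ˡ f c (inj₁ x ∷ xs) with inside? c x
... | yes _ = cong suc (inside-count-⊕ˡ f c xs)
... | no  _ = inside-count-⊕ˡ f c xs
inside-count-⊕ˡ f c (inj₂ _ ∷ xs) = inside-count-⊕ˡ f c xs

inside-count-⊕ʳ : (e : Expr k) {f : Expr k} (c : Cut f) (xs : List (Vertex (e ⊕ f))) →
                  inside-count (cut-⊕ʳ e c) xs ≡ inside-count c (rights xs)
inside-count-⊕ʳ e c [] = refl
inside-count-⊕ʳ e c (inj₂ x ∷ xs) with inside? c x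
... | yes _ = cong suc (inside-count-⊕ʳ e c xs)
... | no  _ = inside-count-⊕ʳ e c xs
inside-count-⊕ʳ e c (inj₁ _ ∷ xs) = inside-count-⊕ʳ e c xs

Balanced : {e : Expr k} → List (Vertex e) → Cut e → Set
Balanced {k} xs c = k < inside-count c xs × inside-count c xs ≤ k + k

-- Descend into a summand as long as one contains more than `k` of the marked vertices `xs`. At a
-- union where neither does, the two sides together hold at most `k + k`, and the whole
-- subexpression is the cut.
balanced-cut : (e : Expr k) {xs : List (Vertex e)} → Unique xs → k < length xs →
               ∃[ c ] Balanced {e = e} xs c
-- A label in `Fin k` forces `k` to be positive, so one marked vertex is too few; two distinct ones
-- do not exist here.
balanced-cut {suc k} (single _) {_ ∷ []} _ (s≤s ())
balanced-cut (single _) {_ ∷ _ ∷ _} ((x≢y ∷ _) ∷ _) _ = contradiction refl x≢y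
balanced-cut {k} (e ⊕ f) {xs} u k<n
  with k ℕ.<? length (lefts xs) | k ℕ.<? length (rights xs)
... | yes k<l | _ =
  let c , b = balanced-cut e (unique-lefts u) k<l
  in cut-⊕ˡ f c , subst (λ m → k < m × m ≤ k + k) (sym (inside-count-⊕ˡ f c xs)) b
... | no _ | yes k<r =
  let c , b = balanced-cut f (unique-rights u) k<r
  in cut-⊕ʳ e c , subst (λ m → k < m × m ≤ k + k) (sym (inside-count-⊕ʳ e c xs)) b
... | no k≮l | no k≮r =
  whole (e ⊕ f) , subst (λ m → k < m × m ≤ k + k) (sym all-inside) (k<n , n≤2k)
  where
  all-inside : inside-count (whole (e ⊕ f)) xs ≡ length xs
  all-inside = cong length (filter-all (inside? (whole (e ⊕ f))) (All.universal (λ _ → tt) xs))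

  n≤2k : length xs ≤ k + k
  n≤2k = subst (_≤ k + k) (sym (length-lefts-rights xs))
               (ℕ.+-mono-≤ (ℕ.≮⇒≥ k≮l) (ℕ.≮⇒≥ k≮r))
balanced-cut (join i j i≢j e) u k<n =
  let c , b = balanced-cut e u k<n in cut-join i≢j c , b
balanced-cut (relabel i j e) u k<n =
  let c , b = balanced-cut e u k<n in cut-relabel i j c , b

-- A lower bound on the number of labels

record PairIncidence (N : ℕ) (G : Graph V) : Set where
  field
    centre-at : Fin N → V
    leaf-at   : Fin N → Fin N → V
    injective : ∀ {a b} → centre-at a ≡ centre-at b → a ≡ b
    adjacent₁ : ∀ {s t} → Adj G (centre-at s) (leaf-at s t)
    adjacent₂ : ∀ {s t} → Adj G (centre-at t) (leaf-at s t)
    only      : ∀ {a s t} → Adj G (centre-at a) (leaf-at s t) → a ≡ s ⊎ a ≡ t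

-- A balanced cut puts at most `k + k` centres inside, so more than `k + k + k` centres leave more
-- than `k` on each side, and `crossed` applies.
pairIncidence-bound : (e : Expr k) → PairIncidence N ⟦ e ⟧ → N ≤ k + k + k
pairIncidence-bound {k} {N} e inc = ℕ.≮⇒≥ too-many
  where
  open PairIncidence inc

  module _ (c : Cut e)
           (k<S : k < length (filter (inside? c ∘ centre-at) (allFin N)))
           (k<T : k < length (filter (¬? ∘ inside? c ∘ centre-at) (allFin N))) where

    S? : Decidable (Inside c ∘ centre-at)
    S? = inside? c ∘ centre-at

    S T : List (Fin N)
    S = filter S? (allFin N)
    T = filter (¬? ∘ S?) (allFin N)

    S-inside : ∀ {s} → s ∈ S → Inside c (centre-at s)
    S-inside = proj₂ ∘ ∈-filter⁻ S? {xs = allFin N}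

    T-outside : ∀ {t} → t ∈ T → ¬ Inside c (centre-at t)
    T-outside = proj₂ ∘ ∈-filter⁻ (¬? ∘ S?) {xs = allFin N}

    disjoint : ∀ {s t} → s ∈ S → t ∈ T → s ≢ t
    disjoint s∈S t∈T refl = T-outside t∈T (S-inside s∈S)

    has-inside-leaf? : Decidable (λ t → Any.Any (λ s → Inside c (leaf-at s t)) S)
    has-inside-leaf? t = Any.any? (λ s → inside? c (leaf-at s t)) S

    crossed : ⊥
    crossed with All.all? has-inside-leaf? T
    ... | yes all =
      let witness  : ∀ {t} → t ∈ T → ∃[ s ] s ∈ S × Inside c (leaf-at s t)
          witness  = find ∘ All.lookup all
          t , t′ , p , q , t≢t′ , eq =
            pigeonhole-∈ (Unique.filter⁺ (¬? ∘ S?) (Unique.allFin⁺ N)) k<T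
              (λ {t} p → class c (leaf-at (proj₁ (witness p)) t))
          s  , _  , inside = witness p
          s′ , s′∈S , inside′ = witness q
          -- The outside centre `t` sees the leaf chosen for `t`, hence also its twin, the leaf
          -- chosen for `t′`. So `t` is `s′` or `t′`, both excluded.
          adj = twins c inside inside′ (T-outside p) eq (adj-sym ⟦ e ⟧ adjacent₂)
      in [ disjoint s′∈S p ∘ sym , t≢t′ ]′ (only (adj-sym ⟦ e ⟧ adj))
    ... | no ¬all =
      let t , t∈T , none = find (All.¬All⇒Any¬ has-inside-leaf? T ¬all)
          s , s′ , p , q , s≢s′ , eq =
            pigeonhole-∈ (Unique.filter⁺ S? (Unique.allFin⁺ N)) k<S
              (λ {s} _ → class c (centre-at s))
          -- The leaf of `s` and `t` lies outside and sees `s`, hence also its twin `s′`, which is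
          -- neither `s` nor `t`.
          adj = twins c (S-inside p) (S-inside q) (none ∘ lose p) eq adjacent₁
      in [ s≢s′ ∘ sym , disjoint q t∈T ]′ (only adj)

  too-many : ¬ k + k + k < N
  too-many 3k<N =
    let c , k<S , S≤2k = balanced-cut e {map centre-at (allFin N)}
          (Unique.map⁺ injective (Unique.allFin⁺ N))
          (subst (k <_) (sym (trans (length-map centre-at (allFin N)) (length-tabulate _)))
            (ℕ.≤-<-trans (ℕ.m≤n+m k (k + k)) 3k<N))
        |S|≡ = length-filter-map (inside? c) centre-at (allFin N)
        N≡S+T = trans (sym (length-tabulate {n = N} (λ i → i)))
                      (length-filter-¬ (inside? c ∘ centre-at) (allFin N))
        -- Only the upper half of the balance makes the outside large; the lower half already makes
        -- `S` large.
        T≰k = λ T≤k → ℕ.<⇒≱ 3k<N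
          (subst (_≤ k + k + k) (sym N≡S+T) (ℕ.+-mono-≤ (subst (_≤ k + k) |S|≡ S≤2k) T≤k))
    in crossed c (subst (k <_) |S|≡ k<S) (ℕ.≰⇒> T≰k)

Nonadjacent : Graph V → Rel V 0ℓ
Nonadjacent G x y = x ≢ y × ¬ Adj G x y

-- Suspensions are atoms

clique-misses : (G : Graph (Fin n)) {K : Subset n} → IsClique G K →
                ∀ {x y} → Nonadjacent G x y → x ∉ K ⊎ y ∉ K
clique-misses G {K} clique {x} {y} (x≢y , x≁y) with x ∈? K | y ∈? K
... | no x∉  | _      = inj₁ x∉
... | yes _  | no y∉  = inj₂ y∉
... | yes x∈ | yes y∈ = contradiction (clique x∈ y∈ x≢y) x≁y

-- `a` is a hub: each other remaining vertex is joined to it by an edge, except possibly `b`, which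
-- is reached through `w`.
connected-via : (G : Graph (Fin n)) {K : Subset n} (a b : Fin n) →
                (∀ v → v ≡ a ⊎ v ≡ b ⊎ Adj G a v) →
                ∃[ w ] w ∉ K × Adj G a w × Adj G b w →
                a ∉ K → ConnectedAfterDeleting G K
connected-via G {K} a b near (w , w∉ , aw , bw) a∉ u∉ v∉ =
  reverse flip (from-a _ u∉) ◅◅ from-a _ v∉
  where
  flip : ∀ {x y} → (G ∖ K) x y → (G ∖ K) y x
  flip (x∉ , y∉ , xy) = y∉ , x∉ , adj-sym G xy

  from-a : ∀ v → v ∉ K → Star (G ∖ K) a v
  from-a v v∉ with near v
  ... | inj₁ refl        = ε
  ... | inj₂ (inj₁ refl) = (a∉ , w∉ , aw) ◅ (w∉ , v∉ , adj-sym G bw) ◅ ε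
  ... | inj₂ (inj₂ av)   = (a∉ , v∉ , av) ◅ ε

-- A clique misses `a` or `b`, and the missed one serves as hub. It also misses `p` or `q`, which
-- supplies the common neighbour that links the two apices.
suspension-isAtom : (G : Graph (Fin n)) (a b p q : Fin n) →
                    Nonadjacent G a b → Nonadjacent G p q →
                    (∀ v → v ≡ a ⊎ v ≡ b ⊎ Adj G a v × Adj G b v) →
                    Adj G a p × Adj G b p → Adj G a q × Adj G b q → IsAtom G
suspension-isAtom G a b p q a∥b p∥q near p~ q~ K (clique , disconnected) = disconnected
  ([ connected-via G a b (Sum.map₂ (Sum.map₂ proj₁) ∘ near) common
   , connected-via G b a ([ inj₂ ∘ inj₁ , Sum.map id (inj₂ ∘ proj₂) ]′ ∘ near) (swap common)
   ]′ (clique-misses G clique a∥b))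
  where
  common : ∃[ w ] w ∉ K × Adj G a w × Adj G b w
  common = [ (λ p∉ → p , p∉ , p~) , (λ q∉ → q , q∉ , q~) ]′ (clique-misses G clique p∥q)

  swap : ∃[ w ] w ∉ K × Adj G a w × Adj G b w → ∃[ w ] w ∉ K × Adj G b w × Adj G a w
  swap (w , w∉ , aw , bw) = w , w∉ , bw , aw

-- Split graphs joined with two apices

Vtx : ℕ → Set
Vtx N = Fin 2 ⊎ (Fin N ⊎ Fin N × Fin N)

pattern apex p   = inj₁ p
pattern centre a = inj₂ (inj₁ a)
pattern leaf s t = inj₂ (inj₂ (s , t))

-- Leaves are indexed by all ordered pairs, which keeps the vertex set a plain product: `leaf s t`
-- and `leaf t s` have the same neighbours, and `leaf s s` has a single centre.
splitSuspension : (N : ℕ) → Graph (Vtx N)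
splitSuspension N .Adj (apex _)   (apex _)   = ⊥
splitSuspension N .Adj (apex _)   (inj₂ _)   = ⊤
splitSuspension N .Adj (inj₂ _)   (apex _)   = ⊤
splitSuspension N .Adj (centre a) (centre b) = a ≢ b
splitSuspension N .Adj (centre a) (leaf s t) = a ≡ s ⊎ a ≡ t
splitSuspension N .Adj (leaf s t) (centre a) = a ≡ s ⊎ a ≡ t
splitSuspension N .Adj (leaf _ _) (leaf _ _) = ⊥
splitSuspension N .adj? (apex _)   (apex _)   = no λ ()
splitSuspension N .adj? (apex _)   (inj₂ _)   = yes tt
splitSuspension N .adj? (inj₂ _)   (apex _)   = yes tt
splitSuspension N .adj? (centre a) (centre b) = ¬? (a Fin.≟ b)
splitSuspension N .adj? (centre a) (leaf s t) = (a Fin.≟ s) ⊎-dec (a Fin.≟ t)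
splitSuspension N .adj? (leaf s t) (centre a) = (a Fin.≟ s) ⊎-dec (a Fin.≟ t)
splitSuspension N .adj? (leaf _ _) (leaf _ _) = no λ ()
splitSuspension N .adj-sym {apex _}   {inj₂ _}   _ = tt
splitSuspension N .adj-sym {inj₂ _}   {apex _}   _ = tt
splitSuspension N .adj-sym {centre _} {centre _} a≢b = a≢b ∘ sym
splitSuspension N .adj-sym {centre _} {leaf _ _} as = as
splitSuspension N .adj-sym {leaf _ _} {centre _} as = as
splitSuspension N .adj-irrefl {apex _}   refl ()
splitSuspension N .adj-irrefl {centre _} refl a≢a = a≢a refl
splitSuspension N .adj-irrefl {leaf _ _} refl ()

private
  G : (N : ℕ) → Graph (Vtx N)
  G = splitSuspension

  _~_ _∥_ : Rel (Vtx N) 0ℓ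
  _~_ = Adj (G _)
  _∥_ = Nonadjacent (G _)

-- Edges and non-edges by kind of vertex

Leaf Apex : Pred (Vtx N) 0ℓ
Leaf x = ∃[ s ] ∃[ t ] x ≡ leaf s t
Apex x = ∃[ p ] x ≡ apex p

nonadjacent-cases : {x y : Vtx N} → x ∥ y → (Leaf x ⊎ Leaf y) ⊎ Apex x × Apex y
nonadjacent-cases {x = leaf _ _} {_}        _ = inj₁ (inj₁ (_ , _ , refl))
nonadjacent-cases {x = apex _}   {leaf _ _} _ = inj₁ (inj₂ (_ , _ , refl))
nonadjacent-cases {x = centre _} {leaf _ _} _ = inj₁ (inj₂ (_ , _ , refl))
nonadjacent-cases {x = apex _}   {apex _}   _ = inj₂ ((_ , refl) , (_ , refl))
nonadjacent-cases {x = apex _}   {centre _} (_ , x≁y) = contradiction tt x≁y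
nonadjacent-cases {x = centre _} {apex _}   (_ , x≁y) = contradiction tt x≁y
nonadjacent-cases {x = centre a} {centre b} (x≢y , x≁y) =
  contradiction (x≢y ∘ cong (inj₂ ∘ inj₁)) x≁y

edge-has-nonleaf : {x y : Vtx N} → x ~ y → ¬ Leaf x ⊎ ¬ Leaf y
edge-has-nonleaf {x = apex _}   _ = inj₁ λ ()
edge-has-nonleaf {x = centre _} _ = inj₁ λ ()
edge-has-nonleaf {x = leaf _ _} {apex _}   _ = inj₂ λ ()
edge-has-nonleaf {x = leaf _ _} {centre _} _ = inj₂ λ ()

∥-sym : {x y : Vtx N} → x ∥ y → y ∥ x
∥-sym {x = x} {y} (x≢y , x≁y) = x≢y ∘ sym , x≁y ∘ adj-sym (G _) {y} {x}

leaves-nonadjacent : {x y : Vtx N} → Leaf x → Leaf y → ¬ x ~ y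
leaves-nonadjacent (_ , _ , refl) (_ , _ , refl) ()

apices-nonadjacent : {x y : Vtx N} → Apex x → Apex y → ¬ x ~ y
apices-nonadjacent (_ , refl) (_ , refl) ()

nonadjacent-to-apex : {x y : Vtx N} → x ∥ y → Apex y → Apex x
nonadjacent-to-apex {x = apex _} _         _          = _ , refl
nonadjacent-to-apex {x = inj₂ _} (_ , x≁y) (_ , refl) = contradiction tt x≁y

-- An apex is non-adjacent only to apices, and these span no edge. This rules out the apex case of
-- `nonadjacent-cases`.
nonadjacent-to-edge : {x y z : Vtx N} → x ~ y → x ∥ z → y ∥ z → ¬ Apex z
nonadjacent-to-edge x~y x∥z y∥z z-apex =
  apices-nonadjacent (nonadjacent-to-apex x∥z z-apex) (nonadjacent-to-apex y∥z z-apex) x~y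

has-leaf : {x y : Vtx N} → x ∥ y → ¬ Apex y → Leaf x ⊎ Leaf y
has-leaf x∥y ¬apex =
  [ id , (λ apices → contradiction (proj₂ apices) ¬apex) ]′ (nonadjacent-cases x∥y)

-- The three forbidden induced subgraphs

embed-nonadjacent : ∀ {H : Graph W} {G : Graph V} (i : InducedSubgraph H G) →
                    ∀ {x y} → x ≢ y → ¬ Adj H x y →
                    Nonadjacent G (InducedSubgraph.embed i x) (InducedSubgraph.embed i y)
embed-nonadjacent i x≢y x≁y =
  x≢y ∘ InducedSubgraph.injective i , x≁y ∘ Equivalence.from (InducedSubgraph.adj-⇔ i _ _)

embed-adjacent : ∀ {H : Graph W} {G : Graph V} (i : InducedSubgraph H G) →
                 ∀ {x y} → Adj H x y →
                 Adj G (InducedSubgraph.embed i x) (InducedSubgraph.embed i y)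
embed-adjacent i = Equivalence.to (InducedSubgraph.adj-⇔ i _ _)

-- Each of the two edges has an end that is not a leaf. These two ends are non-adjacent, and the
-- second is no apex since it misses both ends of the first edge, so one of them would have to be a
-- leaf.
2P₂-free : 2P₂ -Free G N
2P₂-free i =
  let j , j-nonleaf = nonleaf zero
      l , l-nonleaf = nonleaf (suc zero)
  in [ j-nonleaf , l-nonleaf ]′ (has-leaf (across j l)
       (nonadjacent-to-edge (edge zero) (across zero l) (across (suc zero) l)))
  where
  open InducedSubgraph i

  edge : ∀ a → embed (a , zero) ~ embed (a , suc zero)
  edge a = embed-adjacent i (refl , inj₁ refl)

  across : ∀ j l → embed (zero , j) ∥ embed (suc zero , l)
  across j l = embed-nonadjacent i (λ ()) (λ ())

  nonleaf : ∀ a → ∃[ j ] ¬ Leaf (embed (a , j))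
  nonleaf a = [ (λ ¬l → zero , ¬l) , (λ ¬l → suc zero , ¬l) ]′ (edge-has-nonleaf (edge a))

complement-nonadjacent : (_≟_ : DecidableEquality W) (H : Graph W) {G : Graph V}
                         (i : InducedSubgraph (complement _≟_ H) G) → ∀ {x y} → Adj H x y →
                         Nonadjacent G (InducedSubgraph.embed i x) (InducedSubgraph.embed i y)
complement-nonadjacent _≟_ H i xy =
  embed-nonadjacent i (λ x≡y → adj-irrefl H x≡y xy) (λ co → proj₂ co xy)

-- The non-edges 01 and 34 each contain a leaf: 1 misses both ends of the edge 02, and 3 those of
-- the edge 24, so neither is an apex. But 0 and 1 are both adjacent to 3 and 4, while leaves are
-- never adjacent.
co-P₅-free : co-P₅ -Free G N
co-P₅-free i = clash
  (has-leaf 0∥1 (nonadjacent-to-edge (edge (# 0) (# 2)) 0∥1 (∥-sym 1∥2)))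
  (has-leaf (∥-sym 3∥4) (nonadjacent-to-edge (edge (# 2) (# 4)) 2∥3 (∥-sym 3∥4)))
  where
  open InducedSubgraph i

  edge : ∀ x y {xy : True (adj? co-P₅ x y)} → embed x ~ embed y
  edge x y {xy} = embed-adjacent i (toWitness xy)

  nonedge : ∀ x y {xy : True (adj? (P 5) x y)} → embed x ∥ embed y
  nonedge x y {xy} = complement-nonadjacent Fin._≟_ (P 5) i (toWitness xy)

  0∥1 = nonedge (# 0) (# 1)
  1∥2 = nonedge (# 1) (# 2)
  2∥3 = nonedge (# 2) (# 3)
  3∥4 = nonedge (# 3) (# 4)

  clash : Leaf (embed (# 0)) ⊎ Leaf (embed (# 1)) →
          ¬ (Leaf (embed (# 4)) ⊎ Leaf (embed (# 3)))
  clash (inj₁ l) (inj₁ m) = leaves-nonadjacent l m (edge (# 0) (# 4))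
  clash (inj₁ l) (inj₂ m) = leaves-nonadjacent l m (edge (# 0) (# 3))
  clash (inj₂ l) (inj₁ m) = leaves-nonadjacent l m (edge (# 1) (# 4))
  clash (inj₂ l) (inj₂ m) = leaves-nonadjacent l m (edge (# 1) (# 3))

-- Each of the three non-edges contains a leaf or an apex. Two of them agree in kind, yet distinct
-- non-edges are completely joined to each other.
co-3P₂-free : co-3P₂ -Free G N
co-3P₂-free i = clash (kind (# 0)) (kind (# 1)) (kind (# 2))
  where
  open InducedSubgraph i

  Kind : Fin 3 → Set
  Kind a = (∃[ j ] Leaf (embed (a , j))) ⊎ (∃[ j ] Apex (embed (a , j)))

  kind : ∀ a → Kind a
  kind a = Sum.map [ (zero ,_) , (suc zero ,_) ]′ (λ apices → zero , proj₁ apices)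
    (nonadjacent-cases
      (complement-nonadjacent (≡-dec Fin._≟_ Fin._≟_) (3 · P 2) i (refl , inj₁ refl)))

  across : ∀ {a b} → a ≢ b → ∀ {j l} → embed (a , j) ~ embed (b , l)
  across a≢b = embed-adjacent i (a≢b ∘ cong proj₁ , a≢b ∘ proj₁)

  clash : Kind (# 0) → Kind (# 1) → ¬ Kind (# 2)
  clash (inj₁ (_ , l)) (inj₁ (_ , m)) _ = leaves-nonadjacent l m (across λ ())
  clash (inj₁ (_ , l)) _ (inj₁ (_ , m)) = leaves-nonadjacent l m (across λ ())
  clash _ (inj₁ (_ , l)) (inj₁ (_ , m)) = leaves-nonadjacent l m (across λ ())
  clash (inj₂ (_ , l)) (inj₂ (_ , m)) _ = apices-nonadjacent l m (across λ ())
  clash (inj₂ (_ , l)) _ (inj₂ (_ , m)) = apices-nonadjacent l m (across λ ())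
  clash _ (inj₂ (_ , l)) (inj₂ (_ , m)) = apices-nonadjacent l m (across λ ())

-- Transport along isomorphisms and embeddings

pullback : (V → W) → Graph W → Graph V
pullback f G .Adj x y        = Adj G (f x) (f y)
pullback f G .adj? x y       = adj? G (f x) (f y)
pullback f G .adj-sym        = adj-sym G
pullback f G .adj-irrefl x≡y = adj-irrefl G (cong f x≡y)

pullback-≅ : (f : V ↔ W) (G : Graph W) → pullback (Inverse.to f) G ≅ G
pullback-≅ f G = record { bijection = f ; adj-⇔ = λ _ _ → ⇔-id _ }

≅-sym : {G : Graph V} {H : Graph W} → G ≅ H → H ≅ G
≅-sym {H = H} G≅H = record
  { bijection = ↔-sym bijection
  ; adj-⇔     = λ x y → subst₂ (λ x′ y′ → Adj H x′ y′ ⇔ _)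
                  (strictlyInverseˡ x) (strictlyInverseˡ y) (⇔-sym (adj-⇔ (from x) (from y)))
  }
  where
  open _≅_ G≅H
  open Inverse bijection using (from; strictlyInverseˡ)

≅⇒InducedSubgraph : {G : Graph V} {H : Graph W} → G ≅ H → InducedSubgraph G H
≅⇒InducedSubgraph G≅H = record
  { embed     = Inverse.to bijection
  ; injective = Injection.injective (Inverse⇒Injection bijection)
  ; adj-⇔     = adj-⇔
  }
  where open _≅_ G≅H

InducedSubgraph-trans : {U : Set} {F : Graph U} {G : Graph V} {H : Graph W} →
                        InducedSubgraph F G → InducedSubgraph G H → InducedSubgraph F H
InducedSubgraph-trans i j = record
  { embed     = J.embed ∘ I.embed
  ; injective = I.injective ∘ J.injective
  ; adj-⇔     = λ x y → J.adj-⇔ _ _ ⇔-∘ I.adj-⇔ x y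
  }
  where
  module I = InducedSubgraph i
  module J = InducedSubgraph j

-Free-resp-≅ : {U : Set} {F : Graph U} {G : Graph V} {H : Graph W} →
               G ≅ H → F -Free H → F -Free G
-Free-resp-≅ G≅H free i = free (InducedSubgraph-trans i (≅⇒InducedSubgraph G≅H))

-- Split suspensions as atoms of large clique-width

splitSuspension-pairIncidence : {H : Graph V} → InducedSubgraph (G N) H → PairIncidence N H
splitSuspension-pairIncidence i = record
  { centre-at = λ a → embed (centre a)
  ; leaf-at   = λ s t → embed (leaf s t)
  ; injective = inj₁-injective ∘ inj₂-injective ∘ injective
  ; adjacent₁ = embed-adjacent i (inj₁ refl)
  ; adjacent₂ = embed-adjacent i (inj₂ refl)
  ; only      = Equivalence.from (adj-⇔ _ _)
  }
  where open InducedSubgraph i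

splitSuspension-isAtom : {H : Graph (Fin n)} → H ≅ G (2 + N) → IsAtom H
splitSuspension-isAtom {H = H} H≅G = suspension-isAtom H
  -- Two distinct leaves serve as the non-adjacent pair below the apices; the size `2 + N` provides
  -- the two indices.
  (from a) (from b) (from (leaf zero zero)) (from (leaf zero (suc zero)))
  (embed-nonadjacent i (λ ()) (λ ())) (embed-nonadjacent i (λ ()) (λ ())) near
  (embed-adjacent i tt , embed-adjacent i tt) (embed-adjacent i tt , embed-adjacent i tt)
  where
  open Inverse (_≅_.bijection H≅G) using (to; from; strictlyInverseʳ)

  i = ≅⇒InducedSubgraph (≅-sym H≅G)
  a = apex zero
  b = apex (suc zero)

  Near : Fin _ → Set
  Near v = v ≡ from a ⊎ v ≡ from b ⊎ Adj H (from a) v × Adj H (from b) v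

  near-from : ∀ x → Near (from x)
  near-from (apex zero)       = inj₁ refl
  near-from (apex (suc zero)) = inj₂ (inj₁ refl)
  near-from (inj₂ x)          = inj₂ (inj₂ (embed-adjacent i tt , embed-adjacent i tt))

  near : ∀ v → Near v
  near v = subst Near (strictlyInverseʳ v) (near-from (to v))

enumeration : (N : ℕ) → Fin (2 + (N + N * N)) ↔ Vtx N
enumeration N = (↔-refl ⊎-↔ ((↔-refl ⊎-↔ Fin.*↔×) ↔-∘ Fin.+↔⊎)) ↔-∘ Fin.+↔⊎ {2}

lemma28 : UnboundedCliqueWidth
    (λ G → 2P₂ -Free G × co-P₅ -Free G × co-3P₂ -Free G × IsAtom G)
lemma28 (c , bounded) =
  -- The size must exceed three times `c` to contradict the bound, and must have the form `2 + N`
  -- for the graph to be an atom.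
  let M   = 2 + (c + c + c)
      iso = pullback-≅ (enumeration M) (G M)
      k , ((e , e≅H) , _) , k≤c = bounded _
        ( -Free-resp-≅ iso 2P₂-free , -Free-resp-≅ iso co-P₅-free
        , -Free-resp-≅ iso co-3P₂-free , splitSuspension-isAtom iso )
      embedding = InducedSubgraph-trans (≅⇒InducedSubgraph (≅-sym iso))
                                        (≅⇒InducedSubgraph (≅-sym e≅H))
      M≤3k  = pairIncidence-bound e (splitSuspension-pairIncidence embedding)
      3k≤3c = ℕ.+-mono-≤ (ℕ.+-mono-≤ k≤c k≤c) k≤c
  in ℕ.<⇒≱ (ℕ.m≤n+m _ 1) (ℕ.≤-trans M≤3k 3k≤3c)
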